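{- QA-stratified Boolean doctrines are in one-to-one correspondence with first-order Boolean doctrines equipped with a quantifier-free fragment. (Here, the componentwise injective natural transformations in QA-stratified Boolean doctrines are supposed to be subset inclusions.)
   Context: $\mathbb{N}$ contains $0$; $\mathsf{BA}$ is the category of Boolean algebras and Boolean homomorphisms. A first-order Boolean doctrine over a category $\mathsf{C}$ with finite products is a functor $\mathbf{P}\colon\mathsf{C}^{\mathrm{op}}\to\mathsf{BA}$ such that (i) for all $X,Y\in\mathsf{C}$ the map $\mathbf{P}(\mathrm{pr}_1)\colon\mathbf{P}(X)\to\mathbf{P}(X\times Y)$ has a right adjoint $(\forall Y)_X$ (as an order-preserving map between posets); and (ii) for every $f\colon X'\to X$ and every $Y$, $\mathbf{P}(f)\circ(\forall Y)_X=(\forall Y)_{X'}\circ\mathbf{P}(f\times\mathrm{id}_Y)$. A quantifier-free fragment of a first-order Boolean doctrine $\mathbf{P}\colon\mathsf{C}^{\mathrm{op}}\to\mathsf{BA}$ is a subfunctor $\mathbf{P}_0\colon\mathsf{C}^{\mathrm{op}}\to\mathsf{BA}$ of $\mathbf{P}$ (each $\mathbf{P}_0(X)$ is a Boolean subalgebra of $\mathbf{P}(X)$, and each $\mathbf{P}(f)$ restricts to $\mathbf{P}_0(f)$) such that, for each $X$, $\mathbf{P}(X)=\bigcup_{n\in\mathbb{N}}\mathbf{P}_n(X)$, where, inductively for $n\ge 0$, $\mathbf{P}_{n+1}(X)$ is the Boolean subalgebra of $\mathbf{P}(X)$ generated by the union, over all objects $Y$ of $\mathsf{C}$, of the images of $\mathbf{P}_n(X\times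 Y)$ under $(\forall Y)_X$. A QA-one-step Boolean doctrine over a category $\mathsf{C}$ with finite products is a componentwise injective natural transformation $i\colon\mathbf{P}_0\hookrightarrow\mathbf{P}_1$ between functors $\mathsf{C}^{\mathrm{op}}\to\mathsf{BA}$ such that: (1) for all $X,Y\in\mathsf{C}$ and $\beta\in\mathbf{P}_0(X\times Y)$ there is a (necessarily unique) element $(\forall Y)_X\beta\in\mathbf{P}_1(X)$ such that for all $\alpha\in\mathbf{P}_1(X)$: $\alpha\le(\forall Y)_X\beta$ iff $\mathbf{P}_1(\mathrm{pr}_1)(\alpha)\le i_{X\times Y}(\beta)$; (2) for every $f\colon X'\to X$ and every $Y$, $\mathbf{P}_1(f)\circ(\forall Y)_X=(\forall Y)_{X'}\circ\mathbf{P}_0(f\times\mathrm{id}_Y)$; (3) for all $X$, the Boolean algebra $\mathbf{P}_1(X)$ is generated by the union over $Y\in\mathsf{C}$ of the images of $(\forall Y)_X\colon\mathbf{P}_0(X\times Y)\to\mathbf{P}_1(X)$. A QA-stratified Boolean doctrine over a category $\mathsf{C}$ with finite products is a sequence of functors $(\mathbf{P}_n\colon\mathsf{C}^{\mathrm{op}}\to\mathsf{BA})_{n\in\mathbb{N}}$ and QA-one-step Boolean doctrines $(i_n\colon\mathbf{P}_n\hookrightarrow\mathbf{P}_{n+1})_{n\in\mathbb{N}}$, with one-step quantifiers $(\forall Y)_{X,n}\colon\mathbf{P}_n(X\times Y)\to\mathbf{P}_{n+1}(X)$, such that $(i_{n+1})_X\circ(\forall Y)_{X,n}=(\forall Y)_{X,n+1}\circ(i_n)_{X\times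 Y}$ for all $X,Y\in\mathsf{C}$ and $n\in\mathbb{N}$. -}

module Defs where

open import Level using (Level; _⊔_; suc)
open import Algebra.Lattice.Bundles using (BooleanAlgebra)
open import Algebra.Lattice.Morphism.Structures using (IsLatticeHomomorphism)
import Algebra.Lattice.Morphism.Construct.Composition as Composition
import Algebra.Lattice.Morphism.Construct.Identity as Identity
import Algebra.Lattice.Properties.BooleanAlgebra as BooleanAlgebraProperties
open import Data.Nat.Base as ℕ using (ℕ; z≤n; s≤s)
import Data.Nat.Properties as ℕ
open import Data.Product.Base using (Σ; Σ-syntax; ∃; ∃-syntax; _×_; _,_; proj₁; proj₂)
open import Function.Bundles using (_⇔_; Injection; Inverse)
open import Relation.Binary.Bundles using (Poset; Setoid)
open import Relation.Binary.Core using (Rel)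
open import Relation.Binary.Morphism.Bundles using (PosetHomomorphism)
open import Relation.Binary.PropositionalEquality.Core using (_≡_; refl)
open import Relation.Binary.Structures using (IsEquivalence)
open import Relation.Nullary.Decidable.Core using (yes; no)
open import Relation.Nullary.Negation.Core using (contradiction)
open import Relation.Unary using (Pred; _∈_)

------------------------------------------------------------------------
-- Categories with finite products (terminal object and binary products)

record FPCategory (o a e : Level) : Set (suc (o ⊔ a ⊔ e)) where
  infix  4 _≈_
  infixr 9 _∘_
  infixr 7 _⊗_
  infixr 7 _⊗id[_]
  field
    Obj : Set o
    Hom : Obj → Obj → Set a
    _≈_ : ∀ {X Y} → Rel (Hom X Y) e
    id  : ∀ {X} → Hom X X
    _∘_ : ∀ {X Y Z} → Hom Y Z → Hom X Y → Hom X Z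

    isEquivalence : ∀ {X Y} → IsEquivalence (_≈_ {X} {Y})
    ∘-cong    : ∀ {X Y Z} {f f′ : Hom Y Z} {g g′ : Hom X Y} →
                f ≈ f′ → g ≈ g′ → f ∘ g ≈ f′ ∘ g′
    assoc     : ∀ {W X Y Z} (f : Hom Y Z) (g : Hom X Y) (h : Hom W X) →
                (f ∘ g) ∘ h ≈ f ∘ (g ∘ h)
    identityˡ : ∀ {X Y} (f : Hom X Y) → id ∘ f ≈ f
    identityʳ : ∀ {X Y} (f : Hom X Y) → f ∘ id ≈ f

    𝟙        : Obj
    !        : ∀ {X} → Hom X 𝟙
    !-unique : ∀ {X} (f : Hom X 𝟙) → f ≈ !

    _⊗_   : Obj → Obj → Obj
    pr₁   : ∀ {X Y} → Hom (X ⊗ Y) X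
    pr₂   : ∀ {X Y} → Hom (X ⊗ Y) Y
    ⟨_,_⟩ : ∀ {X Y Z} → Hom Z X → Hom Z Y → Hom Z (X ⊗ Y)
    project₁ : ∀ {X Y Z} (f : Hom Z X) (g : Hom Z Y) → pr₁ ∘ ⟨ f , g ⟩ ≈ f
    project₂ : ∀ {X Y Z} (f : Hom Z X) (g : Hom Z Y) → pr₂ ∘ ⟨ f , g ⟩ ≈ g
    ⟨⟩-unique : ∀ {X Y Z} {f : Hom Z X} {g : Hom Z Y} {h : Hom Z (X ⊗ Y)} →
                pr₁ ∘ h ≈ f → pr₂ ∘ h ≈ g → h ≈ ⟨ f , g ⟩

  _⊗id[_] : ∀ {X′ X} → Hom X′ X → (Y : Obj) → Hom (X′ ⊗ Y) (X ⊗ Y)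
  f ⊗id[ Y ] = ⟨ f ∘ pr₁ , id ∘ pr₂ ⟩

------------------------------------------------------------------------
-- Boolean algebras

-- x ≤ y unfolds to x ≈ x ∧ y.
order : ∀ {b ℓ} → BooleanAlgebra b ℓ → Poset b ℓ ℓ
order B = BooleanAlgebraProperties.poset B

record BooleanHom {b ℓ} (A B : BooleanAlgebra b ℓ) : Set (b ⊔ ℓ) where
  private
    module A = BooleanAlgebra A
    module B = BooleanAlgebra B
  field
    ⟦_⟧ : A.Carrier → B.Carrier
    isLatticeHomomorphism : IsLatticeHomomorphism A.rawLattice B.rawLattice ⟦_⟧
    ⊤-homo : ⟦ A.⊤ ⟧ B.≈ B.⊤
    ⊥-homo : ⟦ A.⊥ ⟧ B.≈ B.⊥
    ¬-homo : ∀ x → ⟦ A.¬ x ⟧ B.≈ B.¬ ⟦ x ⟧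

  open IsLatticeHomomorphism isLatticeHomomorphism public
    using (⟦⟧-cong; ∧-homo; ∨-homo)

open BooleanHom public using (⟦_⟧)

module _ {b ℓ} {A : BooleanAlgebra b ℓ} where

  private module A = BooleanAlgebra A

  idHom : BooleanHom A A
  idHom = record
    { ⟦_⟧ = λ x → x
    ; isLatticeHomomorphism = Identity.isLatticeHomomorphism A.rawLattice A.refl
    ; ⊤-homo = A.refl
    ; ⊥-homo = A.refl
    ; ¬-homo = λ _ → A.refl
    }

  _∘ʰ_ : {B C : BooleanAlgebra b ℓ} → BooleanHom B C → BooleanHom A B → BooleanHom A C
  _∘ʰ_ {C = C} g f = record
    { ⟦_⟧ = λ x → ⟦ g ⟧ (⟦ f ⟧ x)
    ; isLatticeHomomorphism = Composition.isLatticeHomomorphism C.trans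
        (BooleanHom.isLatticeHomomorphism f) (BooleanHom.isLatticeHomomorphism g)
    ; ⊤-homo = C.trans (g.⟦⟧-cong f.⊤-homo) g.⊤-homo
    ; ⊥-homo = C.trans (g.⟦⟧-cong f.⊥-homo) g.⊥-homo
    ; ¬-homo = λ x → C.trans (g.⟦⟧-cong (f.¬-homo x)) (g.¬-homo (⟦ f ⟧ x))
    }
    where
      module C = BooleanAlgebra C
      module f = BooleanHom f
      module g = BooleanHom g

module _ {b ℓ} (B : BooleanAlgebra b ℓ) where

  open BooleanAlgebra B

  record IsSubalgebra {p} (S : Pred Carrier p) : Set (b ⊔ ℓ ⊔ p) where
    field
      resp     : ∀ {x y} → x ≈ y → x ∈ S → y ∈ S
      ⊤-closed : ⊤ ∈ S
      ⊥-closed : ⊥ ∈ S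
      ∧-closed : ∀ {x y} → x ∈ S → y ∈ S → x ∧ y ∈ S
      ∨-closed : ∀ {x y} → x ∈ S → y ∈ S → x ∨ y ∈ S
      ¬-closed : ∀ {x} → x ∈ S → ¬ x ∈ S

  -- The Boolean subalgebra generated by S.
  data Generated {p} (S : Pred Carrier p) : Pred Carrier (b ⊔ ℓ ⊔ p) where
    gen  : ∀ {x} → x ∈ S → Generated S x
    resp : ∀ {x y} → x ≈ y → Generated S x → Generated S y
    ⊤-gen : Generated S ⊤
    ⊥-gen : Generated S ⊥
    ∧-gen : ∀ {x y} → Generated S x → Generated S y → Generated S (x ∧ y)
    ∨-gen : ∀ {x y} → Generated S x → Generated S y → Generated S (x ∨ y)
    ¬-gen : ∀ {x} → Generated S x → Generated S (¬ x)

------------------------------------------------------------------------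
-- Doctrines over a fixed category.  The algebras live in a universe at
-- least as large as that of the objects, because P_{n+1}(X) is generated
-- by a union indexed by all objects.

module Doctrine {o a e} (ℓ : Level) (C : FPCategory o a e) where

  open FPCategory C using (Obj; Hom; _∘_; id; _⊗_; pr₁; _⊗id[_])
  private module C = FPCategory C

  b : Level
  b = o ⊔ ℓ

  record Presheaf : Set (suc b ⊔ a ⊔ e) where
    field
      algebra : Obj → BooleanAlgebra b b
      map     : ∀ {X Y} → Hom X Y → BooleanHom (algebra Y) (algebra X)

    open module Alg {X} = BooleanAlgebra (algebra X) public
      using (_≈_)
    open module Ord {X} = Poset (order (algebra X)) public
      using (_≤_)

    ∣_∣ : Obj → Set b
    ∣ X ∣ = BooleanAlgebra.Carrier (algebra X)

    field
      map-cong : ∀ {X Y} {f g : Hom X Y} → f C.≈ g → ∀ α → ⟦ map f ⟧ α ≈ ⟦ map g ⟧ α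
      map-id   : ∀ {X} (α : ∣ X ∣) → ⟦ map id ⟧ α ≈ α
      map-∘    : ∀ {X Y Z} (f : Hom Y Z) (g : Hom X Y) (α : ∣ Z ∣) →
                 ⟦ map (f ∘ g) ⟧ α ≈ ⟦ map g ⟧ (⟦ map f ⟧ α)

  record NatTrans (P Q : Presheaf) : Set (b ⊔ a) where
    private
      module P = Presheaf P
      module Q = Presheaf Q
    field
      at      : ∀ X → BooleanHom (P.algebra X) (Q.algebra X)
      natural : ∀ {X Y} (f : Hom X Y) (α : P.∣ Y ∣) →
                ⟦ at X ⟧ (⟦ P.map f ⟧ α) Q.≈ ⟦ Q.map f ⟧ (⟦ at Y ⟧ α)

  ----------------------------------------------------------------------
  -- First-order Boolean doctrines and quantifier-free fragments

  record FirstOrder (P : Presheaf) : Set (b ⊔ a) where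
    open Presheaf P
    field
      ∀′ : ∀ X Y → PosetHomomorphism (order (algebra (X ⊗ Y))) (order (algebra X))

    ∀[_] : ∀ Y {X} → ∣ X ⊗ Y ∣ → ∣ X ∣
    ∀[ Y ] {X} = PosetHomomorphism.⟦_⟧ (∀′ X Y)

    field
      adjoint : ∀ {X} Y (α : ∣ X ∣) (β : ∣ X ⊗ Y ∣) →
                α ≤ ∀[ Y ] β ⇔ ⟦ map pr₁ ⟧ α ≤ β
      beckChevalley : ∀ {X X′} Y (f : Hom X′ X) (β : ∣ X ⊗ Y ∣) →
                ⟦ map f ⟧ (∀[ Y ] β) ≈ ∀[ Y ] (⟦ map (f ⊗id[ Y ]) ⟧ β)

  module _ {P : Presheaf} (FO : FirstOrder P)
           (P₀ : ∀ X → Pred (Presheaf.∣ P ∣ X) b) where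

    open Presheaf P
    open FirstOrder FO

    -- The n-th Boolean subalgebra P_n(X) of P(X) obtained from P₀.
    Stratum : ℕ → ∀ X → Pred ∣ X ∣ b
    Stratum ℕ.zero    X = P₀ X
    Stratum (ℕ.suc n) X = Generated (algebra X)
      (λ x → ∃[ Y ] Σ[ β ∈ ∣ X ⊗ Y ∣ ] β ∈ Stratum n (X ⊗ Y) × x ≈ ∀[ Y ] β)

    record IsQuantifierFreeFragment : Set (b ⊔ a) where
      field
        isSubalgebra : ∀ X → IsSubalgebra (algebra X) (P₀ X)
        map-closed   : ∀ {X Y} (f : Hom X Y) {α} → α ∈ P₀ Y → ⟦ map f ⟧ α ∈ P₀ X
        exhaustive   : ∀ X (α : ∣ X ∣) → ∃[ n ] α ∈ Stratum n X

  record FragmentedDoctrine : Set (suc b ⊔ a ⊔ e) where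
    field
      P          : Presheaf
      firstOrder : FirstOrder P
      P₀         : ∀ X → Pred (Presheaf.∣ P ∣ X) b
      isFragment : IsQuantifierFreeFragment firstOrder P₀

  ----------------------------------------------------------------------
  -- QA-one-step and QA-stratified Boolean doctrines

  record OneStep (P₀ P₁ : Presheaf) : Set (b ⊔ a) where
    private
      module P₀ = Presheaf P₀
      module P₁ = Presheaf P₁
    field
      i : NatTrans P₀ P₁

    i[_] : ∀ X → P₀.∣ X ∣ → P₁.∣ X ∣
    i[ X ] = ⟦ NatTrans.at i X ⟧

    field
      injective : ∀ {X} {α β : P₀.∣ X ∣} → i[ X ] α P₁.≈ i[ X ] β → α P₀.≈ β
      ∀[_]      : ∀ Y {X} → P₀.∣ X ⊗ Y ∣ → P₁.∣ X ∣
      universal : ∀ {X} Y (β : P₀.∣ X ⊗ Y ∣) (α : P₁.∣ X ∣) →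
                  α P₁.≤ ∀[ Y ] β ⇔ ⟦ P₁.map pr₁ ⟧ α P₁.≤ i[ X ⊗ Y ] β
      beckChevalley : ∀ {X X′} Y (f : Hom X′ X) (β : P₀.∣ X ⊗ Y ∣) →
                  ⟦ P₁.map f ⟧ (∀[ Y ] β) P₁.≈ ∀[ Y ] (⟦ P₀.map (f ⊗id[ Y ]) ⟧ β)
      generated : ∀ X (α : P₁.∣ X ∣) → α ∈ Generated (P₁.algebra X)
                  (λ x → ∃[ Y ] Σ[ β ∈ P₀.∣ X ⊗ Y ∣ ] x P₁.≈ ∀[ Y ] β)

  record StratifiedDoctrine : Set (suc b ⊔ a ⊔ e) where
    field
      P    : ℕ → Presheaf
      step : ∀ n → OneStep (P n) (P (ℕ.suc n))

    module P n = Presheaf (P n)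
    module Step n = OneStep (step n)

    field
      compatible : ∀ n {X} Y (β : P.∣_∣ n (X ⊗ Y)) →
        P._≈_ (ℕ.suc (ℕ.suc n))
          (Step.i[_] (ℕ.suc n) X (Step.∀[_] n Y β))
          (Step.∀[_] (ℕ.suc n) Y (Step.i[_] n (X ⊗ Y) β))

  ----------------------------------------------------------------------
  -- Subset inclusions.  A set-theoretic inclusion compares subsets of a
  -- common set, so the sets interpreting an object X are taken to be
  -- subsets of an arbitrary setoid U X; a subset is a setoid with an
  -- injection into U X.

  module Within (U : Obj → Setoid b b) where

    private module U X = Setoid (U X)

    Subsets : Presheaf → Set b
    Subsets P = ∀ X → Injection (BooleanAlgebra.setoid (Presheaf.algebra P X)) (U X)

    record SubPresheaf : Set (suc b ⊔ a ⊔ e) where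
      field
        presheaf : Presheaf
        subsets  : Subsets presheaf

      open Presheaf presheaf public

      ι : ∀ X → ∣ X ∣ → U.Carrier X
      ι X = Injection.to (subsets X)

    IsInclusion : ∀ (P Q : SubPresheaf) →
      NatTrans (SubPresheaf.presheaf P) (SubPresheaf.presheaf Q) → Set b
    IsInclusion P Q t = ∀ X α →
      U._≈_ X (SubPresheaf.ι Q X (⟦ NatTrans.at t X ⟧ α)) (SubPresheaf.ι P X α)

    -- P(X) ⊆ Q(X) as subsets of U X for all X, and P is a subfunctor of Q.
    record _⊑_ (P Q : SubPresheaf) : Set (b ⊔ a) where
      private
        module P = SubPresheaf P
        module Q = SubPresheaf Q
      field
        inclusion   : NatTrans P.presheaf Q.presheaf
        isInclusion : IsInclusion P Q inclusion

      incl : ∀ X → P.∣ X ∣ → Q.∣ X ∣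
      incl X = ⟦ NatTrans.at inclusion X ⟧

    -- Equality on the nose: the same subsets of U X, the same Boolean
    -- operations and the same action on morphisms.
    _≋_ : SubPresheaf → SubPresheaf → Set (b ⊔ a)
    P ≋ Q = P ⊑ Q × Q ⊑ P

    record FragmentedWithin : Set (suc b ⊔ a ⊔ e) where
      field
        doctrine : FragmentedDoctrine
      open FragmentedDoctrine doctrine public
      field
        subsets : Subsets P

      sub : SubPresheaf
      sub = record { presheaf = P ; subsets = subsets }

    record StratifiedWithin : Set (suc b ⊔ a ⊔ e) where
      field
        doctrine : StratifiedDoctrine
      open StratifiedDoctrine doctrine public
      field
        subsets : ∀ n → Subsets (P n)

      sub : ℕ → SubPresheaf
      sub n = record { presheaf = P n ; subsets = subsets n }

      field
        step-isInclusion : ∀ n → IsInclusion (sub n) (sub (ℕ.suc n)) (Step.i n)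

    -- The quantifiers are determined by their universal properties, so
    -- the equalities below need not mention them.

    record _≈ᶠ_ (F G : FragmentedWithin) : Set (b ⊔ a) where
      private
        module F = FragmentedWithin F
        module G = FragmentedWithin G
      field
        equal : F.sub ≋ G.sub
        P₀-to   : ∀ X {α} → α ∈ F.P₀ X → _⊑_.incl (proj₁ equal) X α ∈ G.P₀ X
        P₀-from : ∀ X {α} → α ∈ G.P₀ X → _⊑_.incl (proj₂ equal) X α ∈ F.P₀ X

    _≈ˢ_ : StratifiedWithin → StratifiedWithin → Set (b ⊔ a)
    S ≈ˢ T = ∀ n → StratifiedWithin.sub S n ≋ StratifiedWithin.sub T n

    -- S is the sequence (P_n) of Boolean subalgebras built from F.
    record _IsStratificationOf_ (S : StratifiedWithin) (F : FragmentedWithin)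
      : Set (b ⊔ a) where
      private
        module S = StratifiedWithin S
        module F = FragmentedWithin F
      field
        sub⊑  : ∀ n → S.sub n ⊑ F.sub
        image : ∀ n X (α : SubPresheaf.∣ F.sub ∣ X) →
          α ∈ Stratum F.firstOrder F.P₀ n X ⇔
          (Σ[ β ∈ SubPresheaf.∣ S.sub n ∣ X ]
             SubPresheaf._≈_ F.sub (_⊑_.incl (sub⊑ n) X β) α)

    --------------------------------------------------------------------
    -- Both kinds of doctrine form setoids

    private
      ⊑-refl : ∀ {P} → P ⊑ P
      ⊑-refl {P} = record
        { inclusion = record
          { at      = λ _ → idHom
          ; natural = λ f α → BooleanAlgebra.refl (Presheaf.algebra (SubPresheaf.presheaf P) _)
          }
        ; isInclusion = λ X α → U.refl X
        }

      ⊑-trans : ∀ {P Q R} → P ⊑ Q → Q ⊑ R → P ⊑ R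
      ⊑-trans {P} {Q} {R} p q = record
        { inclusion = record
          { at      = λ X → q.at X ∘ʰ p.at X
          ; natural = λ {X} f α → BooleanAlgebra.trans (SubPresheaf.algebra R X)
              (BooleanHom.⟦⟧-cong (q.at X) (p.natural f α)) (q.natural f _)
          }
        ; isInclusion = λ X α →
            U.trans X (_⊑_.isInclusion q X _) (_⊑_.isInclusion p X α)
        }
        where
          module p = NatTrans (_⊑_.inclusion p)
          module q = NatTrans (_⊑_.inclusion q)

      ≋-refl : ∀ {P} → P ≋ P
      ≋-refl = ⊑-refl , ⊑-refl

      ≋-sym : ∀ {P Q} → P ≋ Q → Q ≋ P
      ≋-sym (p , q) = q , p

      ≋-trans : ∀ {P Q R} → P ≋ Q → Q ≋ R → P ≋ R
      ≋-trans (p , p′) (q , q′) = ⊑-trans p q , ⊑-trans q′ p′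

    fragmented : Setoid (suc b ⊔ a ⊔ e) (b ⊔ a)
    fragmented = record
      { Carrier = FragmentedWithin
      ; _≈_     = _≈ᶠ_
      ; isEquivalence = record
        { refl  = record { equal = ≋-refl ; P₀-to = λ _ x → x ; P₀-from = λ _ x → x }
        ; sym   = λ p → let open _≈ᶠ_ p in
            record { equal = ≋-sym equal ; P₀-to = P₀-from ; P₀-from = P₀-to }
        ; trans = λ p q → record
            { equal   = ≋-trans (_≈ᶠ_.equal p) (_≈ᶠ_.equal q)
            ; P₀-to   = λ X x → _≈ᶠ_.P₀-to q X (_≈ᶠ_.P₀-to p X x)
            ; P₀-from = λ X x → _≈ᶠ_.P₀-from p X (_≈ᶠ_.P₀-from q X x)
            }
        }
      }

    stratified : Setoid (suc b ⊔ a ⊔ e) (b ⊔ a)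
    stratified = record
      { Carrier = StratifiedWithin
      ; _≈_     = _≈ˢ_
      ; isEquivalence = record
        { refl  = λ n → ≋-refl
        ; sym   = λ p n → ≋-sym (p n)
        ; trans = λ p q n → ≋-trans (p n) (q n)
        }
      }

  ----------------------------------------------------------------------
  -- Working within some U loses no generality: every QA-stratified
  -- doctrine, with arbitrary injections i_n, lies in the setoid of all
  -- pairs (n , α) with α ∈ P_n(X), where two pairs are equal if their
  -- images in P_k(X) agree for all large k.  (A first-order doctrine P
  -- lies in its own underlying setoids.)

  module Union (S : StratifiedDoctrine) where

    open StratifiedDoctrine S

    private
      module B n X = BooleanAlgebra (P.algebra n X)

      i-cong : ∀ n X {α β} → B._≈_ n X α β →
               B._≈_ (ℕ.suc n) X (Step.i[_] n X α) (Step.i[_] n X β)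
      i-cong n X = BooleanHom.⟦⟧-cong (NatTrans.at (Step.i n) X)

      -- The value for k < n is irrelevant.
      image : ∀ {X} n → P.∣_∣ n X → ∀ k → P.∣_∣ k X
      image n α k with n ℕ.≟ k
      image n α k         | yes refl = α
      image {X} n α ℕ.zero    | no _ = B.⊤ 0 X
      image {X} n α (ℕ.suc k) | no _ = Step.i[_] k X (image n α k)

      image-cong : ∀ {X} n {α β} → B._≈_ n X α β →
                   ∀ k → B._≈_ k X (image n α k) (image n β k)
      image-cong n p k with n ℕ.≟ k
      image-cong n p k         | yes refl = p
      image-cong {X} n p ℕ.zero    | no _ = B.refl 0 X
      image-cong {X} n p (ℕ.suc k) | no _ = i-cong k X (image-cong n p k)

      image-self : ∀ {X} n (α : P.∣_∣ n X) → image n α n ≡ α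
      image-self n α with n ℕ.≟ n
      ... | yes p with refl ← ℕ.≡-irrelevant p refl = refl
      ... | no ¬p = contradiction refl ¬p

      image-suc : ∀ {X} n (α : P.∣_∣ n X) k → n ℕ.≤ k →
                  image n α (ℕ.suc k) ≡ Step.i[_] k X (image n α k)
      image-suc n α k n≤k with n ℕ.≟ ℕ.suc k
      ... | yes refl = contradiction n≤k ℕ.1+n≰n
      ... | no _     = refl

      descend : ∀ {X} n {α β : P.∣_∣ n X} j →
                B._≈_ (j ℕ.+ n) X (image n α (j ℕ.+ n)) (image n β (j ℕ.+ n)) →
                B._≈_ n X α β
      descend n {α} {β} ℕ.zero p rewrite image-self n α | image-self n β = p
      descend n {α} {β} (ℕ.suc j) p
        rewrite image-suc n α (j ℕ.+ n) (ℕ.m≤n+m n j)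
              | image-suc n β (j ℕ.+ n) (ℕ.m≤n+m n j)
        = descend n j (Step.injective (j ℕ.+ n) p)

      image-i : ∀ {X} n (α : P.∣_∣ n X) j →
                B._≈_ (j ℕ.+ ℕ.suc n) X
                  (image (ℕ.suc n) (Step.i[_] n X α) (j ℕ.+ ℕ.suc n))
                  (image n α (j ℕ.+ ℕ.suc n))
      image-i {X} n α ℕ.zero
        rewrite image-self (ℕ.suc n) (Step.i[_] n X α)
              | image-suc n α n ℕ.≤-refl
              | image-self n α
        = B.refl (ℕ.suc n) X
      image-i {X} n α (ℕ.suc j)
        rewrite image-suc (ℕ.suc n) (Step.i[_] n X α) (j ℕ.+ ℕ.suc n) (ℕ.m≤n+m (ℕ.suc n) j)
              | image-suc n α (j ℕ.+ ℕ.suc n) (ℕ.≤-trans (ℕ.n≤1+n n) (ℕ.m≤n+m (ℕ.suc n) j))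
        = i-cong (j ℕ.+ ℕ.suc n) X (image-i n α j)

    union : Obj → Setoid b b
    union X = record
      { Carrier = ∃[ n ] P.∣_∣ n X
      ; _≈_     = λ (m , α) (n , β) →
                  ∃[ N ] ∀ k → N ℕ.≤ k → B._≈_ k X (image m α k) (image n β k)
      ; isEquivalence = record
        { refl  = 0 , λ k _ → B.refl k X
        ; sym   = λ (N , p) → N , λ k l → B.sym k X (p k l)
        ; trans = λ (M , p) (N , q) → M ℕ.⊔ N , λ k l → B.trans k X
            (p k (ℕ.≤-trans (ℕ.m≤m⊔n M N) l)) (q k (ℕ.≤-trans (ℕ.m≤n⊔m M N) l))
        }
      }

    open Within union

    within : StratifiedWithin
    within = record
      { doctrine = S
      ; subsets  = λ n X → record
        { to        = n ,_
        ; cong      = λ p → 0 , λ k _ → image-cong n p k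
        ; injective = λ (N , p) → descend n N (p (N ℕ.+ n) (ℕ.m≤m+n N n))
        }
      ; step-isInclusion = λ n X α → ℕ.suc n , λ k l → lemma n α l
      }
      where
        lemma : ∀ {X} n (α : P.∣_∣ n X) {k} → ℕ.suc n ℕ.≤ k →
                B._≈_ k X (image (ℕ.suc n) (Step.i[_] n X α) k) (image n α k)
        lemma n α {k} l with k ℕ.∸ ℕ.suc n | ℕ.m∸n+n≡m l
        ... | j | refl = image-i n α j

{-# OPTIONS --safe #-}

-- Every stratum of a fragmented doctrine is a subfunctor by Beck–Chevalley,
-- and contains the previous one since ∀_𝟙 inverts reindexing along
-- X × 𝟙 → X.  Conversely, the union of a QA-stratified doctrine is computed by
-- moving finitely many elements to a common level: operations and quantifiers
-- do not depend on the level chosen, and the quantifier raises it by one.  The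
-- generation axiom of a one-step doctrine says exactly that the n-th stratum
-- over the 0-th level is the n-th level.

module Submission where

open import Defs
open import Level using (Level; _⊔_)
open import Algebra.Lattice.Bundles using (BooleanAlgebra)
import Algebra.Lattice.Properties.BooleanAlgebra as BooleanAlgebraProperties
open import Algebra.Lattice.Structures.Biased
  using (isDistributiveLatticeʳʲᵐ; isBooleanAlgebraʳ)
open import Data.Nat.Base as ℕ using (ℕ; _≤′_; ≤′-refl; ≤′-step)
import Data.Nat.Properties as ℕ
open import Data.Product.Base
  using (Σ; Σ-syntax; ∃; ∃-syntax; _×_; _,_; proj₁; proj₂)
open import Function.Base using (_on_)
open import Function.Bundles using (_⇔_; mk⇔; Equivalence; Injection; Inverse)
open import Function.Construct.Composition using (_⇔-∘_)
open import Function.Construct.Symmetry using (⇔-sym)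
open import Relation.Binary.Bundles using (Poset; Setoid)
open import Relation.Binary.Consequences using (mono⇒cong)
import Relation.Binary.Construct.On as On
open import Relation.Binary.Morphism.Bundles using (PosetHomomorphism; mkPosetHomo)
open import Relation.Unary using (Pred; _∈_)
import Relation.Binary.Reasoning.Setoid as ≈-Reasoning

-- Boolean homomorphisms and subalgebras.

module _ {b ℓ} {A B : BooleanAlgebra b ℓ} where

  private
    module A = BooleanAlgebra A
    module A′ = BooleanAlgebraProperties A
    module B = BooleanAlgebra B
    module B′ = BooleanAlgebraProperties B

  -- The other operations are definable from `∧` and `¬`: joins by De Morgan, then `⊤` and `⊥` by
  -- the complement laws. Every homomorphism built directly below is checked on these two operations
  -- only.
  ∧-¬-homo⇒booleanHom : (f : A.Carrier → B.Carrier) →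
    (∀ {x y} → x A.≈ y → f x B.≈ f y) →
    (∀ x y → f (x A.∧ y) B.≈ f x B.∧ f y) →
    (∀ x → f (A.¬ x) B.≈ B.¬ f x) →
    BooleanHom A B
  ∧-¬-homo⇒booleanHom f f-cong f-∧ f-¬ = record
    { ⟦_⟧ = f
    ; isLatticeHomomorphism = record
      { isRelHomomorphism = record { cong = f-cong }
      ; ∧-homo = f-∧
      ; ∨-homo = f-∨
      }
    ; ⊤-homo = f-⊤
    ; ⊥-homo = f-⊥
    ; ¬-homo = f-¬
    }
    where
    open ≈-Reasoning B.setoid

    f-∨ : ∀ x y → f (x A.∨ y) B.≈ f x B.∨ f y
    f-∨ x y = begin
      f (x A.∨ y)                      ≈⟨ f-cong (A′.¬-involutive _) ⟨
      f (A.¬ A.¬ (x A.∨ y))            ≈⟨ f-¬ _ ⟩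
      B.¬ f (A.¬ (x A.∨ y))            ≈⟨ B.¬-cong (f-cong (A′.deMorgan₂ x y)) ⟩
      B.¬ f (A.¬ x A.∧ A.¬ y)          ≈⟨ B.¬-cong (f-∧ _ _) ⟩
      B.¬ (f (A.¬ x) B.∧ f (A.¬ y))    ≈⟨ B.¬-cong (B.∧-cong (f-¬ x) (f-¬ y)) ⟩
      B.¬ (B.¬ f x B.∧ B.¬ f y)        ≈⟨ B.¬-cong (B′.deMorgan₂ _ _) ⟨
      B.¬ B.¬ (f x B.∨ f y)            ≈⟨ B′.¬-involutive _ ⟩
      f x B.∨ f y                      ∎

    f-⊤ : f A.⊤ B.≈ B.⊤
    f-⊤ = begin
      f A.⊤                   ≈⟨ f-cong (A.∨-complementʳ A.⊤) ⟨
      f (A.⊤ A.∨ A.¬ A.⊤)     ≈⟨ f-∨ _ _ ⟩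
      f A.⊤ B.∨ f (A.¬ A.⊤)   ≈⟨ B.∨-congˡ (f-¬ _) ⟩
      f A.⊤ B.∨ B.¬ f A.⊤     ≈⟨ B.∨-complementʳ _ ⟩
      B.⊤                     ∎

    f-⊥ : f A.⊥ B.≈ B.⊥
    f-⊥ = begin
      f A.⊥                   ≈⟨ f-cong (A.∧-complementʳ A.⊥) ⟨
      f (A.⊥ A.∧ A.¬ A.⊥)     ≈⟨ f-∧ _ _ ⟩
      f A.⊥ B.∧ f (A.¬ A.⊥)   ≈⟨ B.∧-congˡ (f-¬ _) ⟩
      f A.⊥ B.∧ B.¬ f A.⊥     ≈⟨ B.∧-complementʳ _ ⟩
      B.⊥                     ∎

  mono : (h : BooleanHom A B) → ∀ {x y} →
    Poset._≤_ (order A) x y → Poset._≤_ (order B) (⟦ h ⟧ x) (⟦ h ⟧ y)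
  mono h x≤y = B.trans (h.⟦⟧-cong x≤y) (h.∧-homo _ _)
    where module h = BooleanHom h

module _ {b ℓ p} (B : BooleanAlgebra b ℓ) {S : Pred (BooleanAlgebra.Carrier B) p} where

  Generated-isSubalgebra : IsSubalgebra B (Generated B S)
  Generated-isSubalgebra = record
    { resp = resp
    ; ⊤-closed = ⊤-gen
    ; ⊥-closed = ⊥-gen
    ; ∧-closed = ∧-gen
    ; ∨-closed = ∨-gen
    ; ¬-closed = ¬-gen
    }

module _ {b} (B : BooleanAlgebra b b) {S : Pred (BooleanAlgebra.Carrier B) b}
         (isSubalgebra : IsSubalgebra B S) where

  open BooleanAlgebra B
  open IsSubalgebra isSubalgebra

  subalgebra : BooleanAlgebra b b
  subalgebra = record
    { Carrier = ∃ S
    ; _≈_ = _≈_ on proj₁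
    ; _∨_ = λ (x , p) (y , q) → x ∨ y , ∨-closed p q
    ; _∧_ = λ (x , p) (y , q) → x ∧ y , ∧-closed p q
    ; ¬_  = λ (x , p) → ¬ x , ¬-closed p
    ; ⊤   = ⊤ , ⊤-closed
    ; ⊥   = ⊥ , ⊥-closed
    ; isBooleanAlgebra = record
      { isDistributiveLattice = record
        { isLattice = record
          { isEquivalence = On.isEquivalence proj₁ isEquivalence
          ; ∨-comm  = λ _ _ → ∨-comm _ _
          ; ∨-assoc = λ _ _ _ → ∨-assoc _ _ _
          ; ∨-cong  = ∨-cong
          ; ∧-comm  = λ _ _ → ∧-comm _ _
          ; ∧-assoc = λ _ _ _ → ∧-assoc _ _ _
          ; ∧-cong  = ∧-cong
          ; absorptive = (λ _ _ → ∨-absorbs-∧ _ _) , (λ _ _ → ∧-absorbs-∨ _ _)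
          }
        ; ∨-distrib-∧ = (λ _ _ _ → ∨-distribˡ-∧ _ _ _) , (λ _ _ _ → ∨-distribʳ-∧ _ _ _)
        ; ∧-distrib-∨ = (λ _ _ _ → ∧-distribˡ-∨ _ _ _) , (λ _ _ _ → ∧-distribʳ-∨ _ _ _)
        }
      ; ∨-complement = (λ _ → ∨-complementˡ _) , (λ _ → ∨-complementʳ _)
      ; ∧-complement = (λ _ → ∧-complementˡ _) , (λ _ → ∧-complementʳ _)
      ; ¬-cong = ¬-cong
      }
    }

  subalgebra-inclusion : BooleanHom subalgebra B
  subalgebra-inclusion = ∧-¬-homo⇒booleanHom proj₁ (λ p → p) (λ _ _ → refl) (λ _ → refl)

-- p and q are the values at u and v of a possibly partial right adjoint of f.
module _ {a ℓ₁ ℓ₂ a′ ℓ₁′ ℓ₂′} {P : Poset a ℓ₁ ℓ₂} {Q : Poset a′ ℓ₁′ ℓ₂′} where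

  private
    module P = Poset P
    module Q = Poset Q

  rightAdjoint-mono : (f : P.Carrier → Q.Carrier) {p q : P.Carrier} {u v : Q.Carrier} →
    (∀ α → α P.≤ p ⇔ f α Q.≤ u) → (∀ α → α P.≤ q ⇔ f α Q.≤ v) → u Q.≤ v → p P.≤ q
  rightAdjoint-mono f {p} p-adj q-adj u≤v =
    Equivalence.from (q-adj p) (Q.trans (Equivalence.to (p-adj p) P.refl) u≤v)

module _ {o a e} (ℓ : Level) (C : FPCategory o a e) where

  open Doctrine ℓ C
  open FPCategory C using (Obj; Hom; id; _⊗_; pr₁; _⊗id[_]; 𝟙; !; ⟨_,_⟩; project₁)

  module Order (P : Presheaf) where
    open Presheaf P public
    module _ {X : Obj} where
      open BooleanAlgebra (algebra X) public
        using (refl; sym; trans; ∧-cong; ∨-cong; ¬-cong; _∧_; _∨_; ¬_; ⊤; ⊥)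
      open Poset (order (algebra X)) public
        using (antisym; ≤-respˡ-≈; ≤-respʳ-≈)
        renaming (refl to ≤-refl; trans to ≤-trans; reflexive to ≤-reflexive)

    module _ {X Y} (f : Hom X Y) where
      open BooleanHom (map f) public using () renaming (⟦⟧-cong to map-≈)

    map-mono : ∀ {X Y} (f : Hom X Y) {α β : ∣ Y ∣} → α ≤ β → ⟦ map f ⟧ α ≤ ⟦ map f ⟧ β
    map-mono f = mono (map f)

  -- One inequality is the unit of the adjunction. The other is its counit reindexed along the
  -- section `⟨ id , ! ⟩` of `pr₁`, which exists because the quantified object is terminal.
  ∀-vacuous : ∀ {P} (FO : FirstOrder P) → let open Presheaf P in let open FirstOrder FO in
    ∀ {X} (α : ∣ X ∣) → α ≈ ∀[ 𝟙 ] (⟦ map pr₁ ⟧ α)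
  ∀-vacuous {P} FO {X} α = P.antisym
    (Equivalence.from (FO.adjoint 𝟙 α _) P.≤-refl)
    (P.≤-respˡ-≈ (section _) (P.≤-respʳ-≈ (section α)
      (P.map-mono s (Equivalence.to (FO.adjoint 𝟙 _ _) P.≤-refl))))
    where
    module P = Order P
    module FO = FirstOrder FO

    s : Hom X (X ⊗ 𝟙)
    s = ⟨ id , ! ⟩

    section : ∀ β → ⟦ P.map s ⟧ (⟦ P.map pr₁ ⟧ β) P.≈ β
    section β = P.trans (P.sym (P.map-∘ pr₁ s β))
      (P.trans (P.map-cong (project₁ id !) β) (P.map-id β))

  -- The strata of a fragmented doctrine.

  module Strata {P : Presheaf} (FO : FirstOrder P) {P₀ : ∀ X → Pred (Presheaf.∣ P ∣ X) b}
                (isFragment : IsQuantifierFreeFragment FO P₀) where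

    private
      module P = Order P
      module FO = FirstOrder FO
      open IsQuantifierFreeFragment isFragment

    S : ℕ → ∀ X → Pred (P.∣ X ∣) b
    S = Stratum FO P₀

    S-isSubalgebra : ∀ n X → IsSubalgebra (P.algebra X) (S n X)
    S-isSubalgebra ℕ.zero = isSubalgebra
    S-isSubalgebra (ℕ.suc n) X = Generated-isSubalgebra (P.algebra X)

    S-resp : ∀ n {X} {α β : P.∣ X ∣} → α P.≈ β → α ∈ S n X → β ∈ S n X
    S-resp n = IsSubalgebra.resp (S-isSubalgebra n _)

    -- Beck-Chevalley turns a reindexed generator into the quantification of an element reindexed
    -- along `f ⊗id[ Y ]`, and that element stays in the lower stratum by induction. The Boolean
    -- operations commute with reindexing.
    S-map : ∀ n {X Y} (f : Hom X Y) {α} → α ∈ S n Y → ⟦ P.map f ⟧ α ∈ S n X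
    S-map ℕ.zero f α∈ = map-closed f α∈
    S-map (ℕ.suc n) f (gen (Y , β , β∈ , α≈)) = gen
      (Y , _ , S-map n (f ⊗id[ Y ]) β∈ , P.trans (P.map-≈ f α≈) (FO.beckChevalley Y f β))
    S-map (ℕ.suc n) f (resp α≈β α∈) = resp (P.map-≈ f α≈β) (S-map (ℕ.suc n) f α∈)
    S-map (ℕ.suc n) f ⊤-gen = resp (P.sym (BooleanHom.⊤-homo (P.map f))) ⊤-gen
    S-map (ℕ.suc n) f ⊥-gen = resp (P.sym (BooleanHom.⊥-homo (P.map f))) ⊥-gen
    S-map (ℕ.suc n) f (∧-gen α∈ β∈) = resp (P.sym (BooleanHom.∧-homo (P.map f) _ _))
      (∧-gen (S-map (ℕ.suc n) f α∈) (S-map (ℕ.suc n) f β∈))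
    S-map (ℕ.suc n) f (∨-gen α∈ β∈) = resp (P.sym (BooleanHom.∨-homo (P.map f) _ _))
      (∨-gen (S-map (ℕ.suc n) f α∈) (S-map (ℕ.suc n) f β∈))
    S-map (ℕ.suc n) f (¬-gen α∈) = resp (P.sym (BooleanHom.¬-homo (P.map f) _))
      (¬-gen (S-map (ℕ.suc n) f α∈))

    S-suc : ∀ n {X} {α : P.∣ X ∣} → α ∈ S n X → α ∈ S (ℕ.suc n) X
    S-suc n {α = α} α∈ = gen (𝟙 , _ , S-map n pr₁ α∈ , ∀-vacuous FO α)

    presheaf : ℕ → Presheaf
    presheaf n = record
      { algebra  = λ X → subalgebra (P.algebra X) (S-isSubalgebra n X)
      ; map      = λ f → ∧-¬-homo⇒booleanHom
          (λ (α , α∈) → ⟦ P.map f ⟧ α , S-map n f α∈)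
          (P.map-≈ f)
          (λ _ _ → BooleanHom.∧-homo (P.map f) _ _)
          (λ _ → BooleanHom.¬-homo (P.map f) _)
      ; map-cong = λ f≈g (α , _) → P.map-cong f≈g α
      ; map-id   = λ (α , _) → P.map-id α
      ; map-∘    = λ f g (α , _) → P.map-∘ f g α
      }

    inclusion : ∀ n → NatTrans (presheaf n) P
    inclusion n = record
      { at      = λ X → subalgebra-inclusion (P.algebra X) (S-isSubalgebra n X)
      ; natural = λ _ _ → P.refl
      }

    ∀-step : ∀ n Y {X} → Presheaf.∣ presheaf n ∣ (X ⊗ Y) → Presheaf.∣ presheaf (ℕ.suc n) ∣ X
    ∀-step n Y (β , β∈) = FO.∀[ Y ] β , gen (Y , β , β∈ , P.refl)

    private
      ∀-image : ∀ n X → Pred (Presheaf.∣ presheaf (ℕ.suc n) ∣ X) _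
      ∀-image n X α = ∃[ Y ] Σ[ β ∈ Presheaf.∣ presheaf n ∣ (X ⊗ Y) ]
        Presheaf._≈_ (presheaf (ℕ.suc n)) α (∀-step n Y β)

    -- A stratum is generated inside `P`, while the one-step axiom asks for generation inside the
    -- stratum itself. The derivation `α∈` is replayed there, each generator keeping its witness.
    step-generated : ∀ n X {α} (α∈ : α ∈ S (ℕ.suc n) X) →
      (α , α∈) ∈ Generated (Presheaf.algebra (presheaf (ℕ.suc n)) X) (∀-image n X)
    step-generated n X (gen (Y , β , β∈ , α≈)) = gen (Y , (β , β∈) , α≈)
    step-generated n X (resp α≈β α∈)  = resp α≈β (step-generated n X α∈)
    step-generated n X ⊤-gen          = resp P.refl ⊤-gen
    step-generated n X ⊥-gen          = resp P.refl ⊥-gen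
    step-generated n X (∧-gen α∈ β∈)  =
      resp P.refl (∧-gen (step-generated n X α∈) (step-generated n X β∈))
    step-generated n X (∨-gen α∈ β∈)  =
      resp P.refl (∨-gen (step-generated n X α∈) (step-generated n X β∈))
    step-generated n X (¬-gen α∈)     = resp P.refl (¬-gen (step-generated n X α∈))

    -- Equality and order in a stratum are those of first components, so every axiom except
    -- generation is inherited from `P` by restriction.
    stratification : StratifiedDoctrine
    stratification = record
      { P    = presheaf
      ; step = λ n → record
        { i = record
          { at      = λ X → ∧-¬-homo⇒booleanHom (λ (α , α∈) → α , S-suc n α∈)
                      (λ p → p) (λ _ _ → P.refl) (λ _ → P.refl)
          ; natural = λ _ _ → P.refl
          }
        ; injective     = λ p → p
        ; ∀[_]          = ∀-step n
        ; universal     = λ Y (β , _) (α , _) → FO.adjoint Y α β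
        ; beckChevalley = λ Y f (β , _) → FO.beckChevalley Y f β
        ; generated     = λ X (α , α∈) → step-generated n X α∈
        }
      ; compatible = λ n Y β → P.refl
      }

  -- Comparing subpresheaves inside a common family of setoids.

  module _ (U : Obj → Setoid b b) where

    open Within U

    private
      module U X = Setoid (U X)

    module Sub (P : SubPresheaf) where
      open SubPresheaf P public using (subsets; ι)
      open Order (SubPresheaf.presheaf P) public

      module _ {X : Obj} where
        ι-cong : ∀ {α β : ∣ X ∣} → α ≈ β → U._≈_ X (ι X α) (ι X β)
        ι-cong = Injection.cong (subsets X)

        ι-injective : ∀ {α β : ∣ X ∣} → U._≈_ X (ι X α) (ι X β) → α ≈ β
        ι-injective = Injection.injective (subsets X)

    module Incl {P Q : SubPresheaf} (p : P ⊑ Q) where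
      open _⊑_ p public using (incl; isInclusion)
      open NatTrans (_⊑_.inclusion p) public using (at; natural)
      module _ {X : Obj} where
        open BooleanHom (at X) public using (⟦⟧-cong; ∧-homo; ∨-homo; ¬-homo; ⊤-homo; ⊥-homo)

    ⊑-refl : ∀ {P} → P ⊑ P
    ⊑-refl {P} = record
      { inclusion   = record { at = λ _ → idHom ; natural = λ _ _ → Sub.refl P }
      ; isInclusion = λ X _ → U.refl X
      }

    ⊑-trans : ∀ {P Q R} → P ⊑ Q → Q ⊑ R → P ⊑ R
    ⊑-trans {R = R} p q = record
      { inclusion = record
        { at      = λ X → q.at X ∘ʰ p.at X
        ; natural = λ f α → Sub.trans R (q.⟦⟧-cong (p.natural f α)) (q.natural f _)
        }
      ; isInclusion = λ X α → U.trans X (q.isInclusion X _) (p.isInclusion X α)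
      }
      where
      module p = Incl p
      module q = Incl q

    module Agreement {P Q R : SubPresheaf} (p : P ⊑ R) (q : Q ⊑ R) where

      private
        module P = Sub P
        module Q = Sub Q
        module R = Sub R
        module p = Incl p
        module q = Incl q

      -- Equality in `U X` relates elements of different subpresheaves. Since `P` and `Q` both lie
      -- in `R`, it amounts to equality in `R`, and hence respects the Boolean operations and
      -- reindexing.
      _∼_ : ∀ {X} → P.∣ X ∣ → Q.∣ X ∣ → Set b
      _∼_ {X} α β = U._≈_ X (P.ι X α) (Q.ι X β)

      module _ {X : Obj} where

        ∼⇒≈ : ∀ {α : P.∣ X ∣} {β} → α ∼ β → p.incl X α R.≈ q.incl X β
        ∼⇒≈ α∼β = R.ι-injective
          (U.trans X (p.isInclusion X _) (U.trans X α∼β (U.sym X (q.isInclusion X _))))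

        ≈⇒∼ : ∀ {α : P.∣ X ∣} {β} → p.incl X α R.≈ q.incl X β → α ∼ β
        ≈⇒∼ α≈β = U.trans X (U.sym X (p.isInclusion X _))
          (U.trans X (R.ι-cong α≈β) (q.isInclusion X _))

        ∧-∼ : ∀ {α α′ : P.∣ X ∣} {β β′} → α ∼ β → α′ ∼ β′ → (α P.∧ α′) ∼ (β Q.∧ β′)
        ∧-∼ r r′ = ≈⇒∼ (R.trans (p.∧-homo _ _)
          (R.trans (R.∧-cong (∼⇒≈ r) (∼⇒≈ r′)) (R.sym (q.∧-homo _ _))))

        ∨-∼ : ∀ {α α′ : P.∣ X ∣} {β β′} → α ∼ β → α′ ∼ β′ → (α P.∨ α′) ∼ (β Q.∨ β′)
        ∨-∼ r r′ = ≈⇒∼ (R.trans (p.∨-homo _ _)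
          (R.trans (R.∨-cong (∼⇒≈ r) (∼⇒≈ r′)) (R.sym (q.∨-homo _ _))))

        ¬-∼ : ∀ {α : P.∣ X ∣} {β} → α ∼ β → (P.¬ α) ∼ (Q.¬ β)
        ¬-∼ r = ≈⇒∼ (R.trans (p.¬-homo _) (R.trans (R.¬-cong (∼⇒≈ r)) (R.sym (q.¬-homo _))))

        ⊤-∼ : P.⊤ {X} ∼ Q.⊤
        ⊤-∼ = ≈⇒∼ (R.trans p.⊤-homo (R.sym q.⊤-homo))

        ⊥-∼ : P.⊥ {X} ∼ Q.⊥
        ⊥-∼ = ≈⇒∼ (R.trans p.⊥-homo (R.sym q.⊥-homo))

      map-∼ : ∀ {X Y} (f : Hom X Y) {α : P.∣ Y ∣} {β} → α ∼ β →
              ⟦ P.map f ⟧ α ∼ ⟦ Q.map f ⟧ β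
      map-∼ f r = ≈⇒∼ (R.trans (p.natural f _)
        (R.trans (R.map-≈ f (∼⇒≈ r)) (R.sym (q.natural f _))))

      -- By injectivity of `Q.ι`, `f X α` is the only element of `Q` that agrees with `α`. As `∼`
      -- respects all the structure, `f` must preserve it.
      factor : (f : ∀ X → P.∣ X ∣ → Q.∣ X ∣) → (∀ X α → α ∼ f X α) → P ⊑ Q
      factor f f-∼ = record
        { inclusion = record
          { at = λ X → ∧-¬-homo⇒booleanHom (f X)
              (λ α≈β → reflect (U.trans X (P.ι-cong α≈β) (f-∼ X _)))
              (λ _ _ → reflect (∧-∼ (f-∼ X _) (f-∼ X _)))
              (λ _ → reflect (¬-∼ (f-∼ X _)))
          ; natural = λ g α → reflect (map-∼ g (f-∼ _ α))
          }
        ; isInclusion = λ X α → U.sym X (f-∼ X α)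
        }
        where
        reflect : ∀ {X} {α : P.∣ X ∣} {β} → α ∼ β → f X α Q.≈ β
        reflect {X} {α} r = Q.ι-injective (U.trans X (U.sym X (f-∼ X α)) r)

    module Fragmented (F : FragmentedWithin) where
      open FragmentedWithin F public
      open Sub sub public hiding (subsets)
      open FirstOrder firstOrder public
      open IsQuantifierFreeFragment isFragment public

    -- Stratification and its invariance under equality.

    stratify : (F : FragmentedWithin) → StratifiedWithin
    stratify F = record
      { doctrine = stratification
      ; subsets  = λ n X → record
        { to = λ (α , _) → F.ι X α ; cong = F.ι-cong ; injective = F.ι-injective }
      ; step-isInclusion = λ n X _ → U.refl X
      }
      where
      module F = Fragmented F
      open Strata F.firstOrder F.isFragment

    module _ (F : FragmentedWithin) where

      private
        module F = Fragmented F
        open Strata F.firstOrder F.isFragment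

      stratum⊑ : ∀ n → StratifiedWithin.sub (stratify F) n ⊑ F.sub
      stratum⊑ n = record { inclusion = inclusion n ; isInclusion = λ X _ → U.refl X }

      stratify-isStratification : stratify F IsStratificationOf F
      stratify-isStratification = record
        { sub⊑  = stratum⊑
        ; image = λ n X α → mk⇔ (λ α∈ → (α , α∈) , F.refl)
            (λ ((β , β∈) , β≈α) → S-resp n β≈α β∈)
        }

    module _ {F G : FragmentedWithin}
             (p : FragmentedWithin.sub F ⊑ FragmentedWithin.sub G)
             (q : FragmentedWithin.sub G ⊑ FragmentedWithin.sub F) where

      private
        module F = Fragmented F
        module G = Fragmented G
        module p = Incl p
        module q = Incl q

      qp≈id : ∀ {X} (α : F.∣ X ∣) → q.incl X (p.incl X α) F.≈ α
      qp≈id {X} α = F.ι-injective (U.trans X (q.isInclusion X _) (p.isInclusion X α))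

      -- The inclusion is monotone and commutes with `pr₁`-reindexing, so it sends the counit for
      -- `F` to an inequality in `G`, whose transpose is this bound.
      incl-∀≤∀-incl : ∀ {X} Y (β : F.∣ X ⊗ Y ∣) →
        p.incl X (F.∀[ Y ] β) G.≤ G.∀[ Y ] (p.incl _ β)
      incl-∀≤∀-incl Y β = Equivalence.from (G.adjoint Y _ _)
        (G.≤-respˡ-≈ (p.natural pr₁ _)
          (mono (p.at _) (Equivalence.to (F.adjoint Y _ β) F.≤-refl)))

    module _ {F G : FragmentedWithin}
             (p : FragmentedWithin.sub F ⊑ FragmentedWithin.sub G)
             (q : FragmentedWithin.sub G ⊑ FragmentedWithin.sub F) where

      private
        module F = Fragmented F
        module G = Fragmented G
        module p = Incl p
        module q = Incl q

      -- The missing inequality is the bound above with `F` and `G` exchanged, carried back along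
      -- `p`. The bound is proved in a separate module so that it can be instantiated both ways.
      -- Quantifiers are thus determined by the underlying subpresheaf.
      incl-∀ : ∀ {X} Y (β : F.∣ X ⊗ Y ∣) →
        p.incl X (F.∀[ Y ] β) G.≈ G.∀[ Y ] (p.incl _ β)
      incl-∀ Y β = G.antisym (incl-∀≤∀-incl {F} {G} p q Y β)
        (G.≤-respˡ-≈ (qp≈id {G} {F} q p _)
          (mono (p.at _) (F.≤-trans (incl-∀≤∀-incl {G} {F} q p Y _)
            (PosetHomomorphism.mono (F.∀′ _ Y) (F.≤-reflexive (qp≈id {F} {G} p q β))))))

      incl-Stratum : (∀ X {α} → α ∈ F.P₀ X → p.incl X α ∈ G.P₀ X) →
        ∀ n {X α} → α ∈ Stratum F.firstOrder F.P₀ n X →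
        p.incl X α ∈ Stratum G.firstOrder G.P₀ n X
      incl-Stratum P₀-to = go
        where
        go : ∀ n {X α} → α ∈ Stratum F.firstOrder F.P₀ n X →
             p.incl X α ∈ Stratum G.firstOrder G.P₀ n X
        go ℕ.zero {X} α∈ = P₀-to X α∈
        go (ℕ.suc n) (gen (Y , β , β∈ , α≈)) =
          gen (Y , p.incl _ β , go n β∈ , G.trans (p.⟦⟧-cong α≈) (incl-∀ Y β))
        go (ℕ.suc n) (resp α≈β α∈) = resp (p.⟦⟧-cong α≈β) (go (ℕ.suc n) α∈)
        go (ℕ.suc n) ⊤-gen = resp (G.sym p.⊤-homo) ⊤-gen
        go (ℕ.suc n) ⊥-gen = resp (G.sym p.⊥-homo) ⊥-gen
        go (ℕ.suc n) (∧-gen α∈ β∈) =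
          resp (G.sym (p.∧-homo _ _)) (∧-gen (go (ℕ.suc n) α∈) (go (ℕ.suc n) β∈))
        go (ℕ.suc n) (∨-gen α∈ β∈) =
          resp (G.sym (p.∨-homo _ _)) (∨-gen (go (ℕ.suc n) α∈) (go (ℕ.suc n) β∈))
        go (ℕ.suc n) (¬-gen α∈) = resp (G.sym (p.¬-homo _)) (¬-gen (go (ℕ.suc n) α∈))

      stratify-mono : (∀ X {α} → α ∈ F.P₀ X → p.incl X α ∈ G.P₀ X) →
        ∀ n → StratifiedWithin.sub (stratify F) n ⊑ StratifiedWithin.sub (stratify G) n
      stratify-mono P₀-to n = Agreement.factor (⊑-trans (stratum⊑ F n) p) (stratum⊑ G n)
        (λ X (α , α∈) → p.incl X α , incl-Stratum P₀-to n α∈)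
        (λ X (α , _) → U.sym X (p.isInclusion X α))

    stratify-cong : ∀ {F G} → F ≈ᶠ G → stratify F ≈ˢ stratify G
    stratify-cong {F} {G} F≈G n =
      stratify-mono {F} {G} p q P₀-to n , stratify-mono {G} {F} q p P₀-from n
      where
      open _≈ᶠ_ F≈G
      p = proj₁ equal
      q = proj₂ equal

    -- The union of a stratified doctrine as a presheaf.

    module Directed (S : StratifiedWithin) where

      private
        module S = StratifiedWithin S
        module P n = Sub (S.sub n)
        module B n {X} = BooleanAlgebra (P.algebra n X)

      lift : ∀ {m n} → m ≤′ n → S.sub m ⊑ S.sub n
      lift ≤′-refl = ⊑-refl
      lift (≤′-step {n} m≤n) = ⊑-trans (lift m≤n)
        (record { inclusion = S.Step.i n ; isInclusion = S.step-isInclusion n })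

      ∀-mono : ∀ n {X} Y {β β′ : P.∣_∣ n (X ⊗ Y)} → P._≤_ n β β′ →
               P._≤_ (ℕ.suc n) (S.Step.∀[_] n Y β) (S.Step.∀[_] n Y β′)
      ∀-mono n {X} Y β≤β′ = rightAdjoint-mono
        {P = order (P.algebra (ℕ.suc n) X)} {Q = order (P.algebra (ℕ.suc n) (X ⊗ Y))}
        ⟦ P.map (ℕ.suc n) pr₁ ⟧
        (S.Step.universal n Y _) (S.Step.universal n Y _)
        (mono (NatTrans.at (S.Step.i n) _) β≤β′)

      -- A one-step quantifier is given as a bare function. That it respects equality comes from its
      -- universal property, through monotonicity and antisymmetry.
      ∀-cong : ∀ n {X} Y {β β′ : P.∣_∣ n (X ⊗ Y)} → P._≈_ n β β′ →
               P._≈_ (ℕ.suc n) (S.Step.∀[_] n Y β) (S.Step.∀[_] n Y β′)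
      ∀-cong n Y = mono⇒cong (P._≈_ n) (P._≈_ (ℕ.suc n)) (P.sym n) (P.≤-reflexive n)
        (P.antisym (ℕ.suc n)) (∀-mono n Y)

      -- Induction on `m≤n` with one use of `compatible` per step. The two sides live at levels
      -- `suc n` and `suc m`, so they are compared in `U X`.
      lift-∀ : ∀ {m n} (m≤n : m ≤′ n) {X} Y (β : P.∣_∣ m (X ⊗ Y)) →
        U._≈_ X (P.ι (ℕ.suc n) X (S.Step.∀[_] n Y (_⊑_.incl (lift m≤n) _ β)))
                (P.ι (ℕ.suc m) X (S.Step.∀[_] m Y β))
      lift-∀ ≤′-refl {X} Y β = U.refl X
      lift-∀ (≤′-step {n} m≤n) {X} Y β = U.trans X
        (P.ι-cong (ℕ.suc (ℕ.suc n)) (P.sym (ℕ.suc (ℕ.suc n)) (S.compatible n Y _)))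
        (U.trans X (S.step-isInclusion (ℕ.suc n) X _) (lift-∀ m≤n Y β))

      -- The directed union is encoded as the disjoint union of the levels, with equality taken in
      -- `U X`. The level is thus only part of a representation.
      Element : Obj → Set b
      Element X = ∃[ n ] P.∣_∣ n X

      el : ∀ {X} → Element X → U.Carrier X
      el {X} (n , α) = P.ι n X α

      -- The level `n` of the representative `α` is unrelated to the one stored in `x`, and may be
      -- lower. Being a record, the relation lets `x` and `α` be inferred from its type.
      record _∼_ {X} (x : Element X) {n} (α : P.∣_∣ n X) : Set b where
        constructor represents
        field el≈ι : U._≈_ X (el x) (P.ι n X α)
      open _∼_

      ∼-self : ∀ {X n} (α : P.∣_∣ n X) → (n , α) ∼ α
      ∼-self {X} α = represents (U.refl X)

      ∼-lift : ∀ {X m n} {x : Element X} {α : P.∣_∣ m X} (m≤n : m ≤′ n) →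
               x ∼ α → x ∼ _⊑_.incl (lift m≤n) X α
      ∼-lift {X} m≤n r = represents
        (U.trans X (el≈ι r) (U.sym X (_⊑_.isInclusion (lift m≤n) X _)))

      m≤′m⊔n : ∀ m n → m ≤′ m ℕ.⊔ n
      m≤′m⊔n m n = ℕ.≤⇒≤′ (ℕ.m≤m⊔n m n)

      n≤′m⊔n : ∀ m n → n ≤′ m ℕ.⊔ n
      n≤′m⊔n m n = ℕ.≤⇒≤′ (ℕ.m≤n⊔m m n)

      module Levels m n = Agreement (lift (m≤′m⊔n m n)) (lift (n≤′m⊔n m n))

      liftˡ : ∀ {X} m n → P.∣_∣ m X → P.∣_∣ (m ℕ.⊔ n) X
      liftˡ m n = _⊑_.incl (lift (m≤′m⊔n m n)) _

      liftʳ : ∀ {X} m n → P.∣_∣ n X → P.∣_∣ (m ℕ.⊔ n) X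
      liftʳ m n = _⊑_.incl (lift (n≤′m⊔n m n)) _

      module _ {X : Obj} where

        infix  4 _≈_
        infixr 7 _∧_
        infixr 6 _∨_
        infix  8 ¬_

        _≈_ : Element X → Element X → Set b
        x ≈ y = U._≈_ X (el x) (el y)

        _∧_ _∨_ : Element X → Element X → Element X
        (m , α) ∧ (n , β) = m ℕ.⊔ n , P._∧_ (m ℕ.⊔ n) (liftˡ m n α) (liftʳ m n β)
        (m , α) ∨ (n , β) = m ℕ.⊔ n , P._∨_ (m ℕ.⊔ n) (liftˡ m n α) (liftʳ m n β)

        ¬_ : Element X → Element X
        ¬ (n , α) = n , P.¬_ n α

        ⊤ ⊥ : Element X
        ⊤ = 0 , P.⊤ 0
        ⊥ = 0 , P.⊥ 0

        private variable
          n : ℕ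
          x y : Element X
          α β : P.∣_∣ n X

        ∼-resp : x ≈ y → x ∼ α → y ∼ α
        ∼-resp x≈y r = represents (U.trans X (U.sym X x≈y) (el≈ι r))

        ∼-respʳ : P._≈_ n α β → x ∼ α → x ∼ β
        ∼-respʳ {n} α≈β r = represents (U.trans X (el≈ι r) (P.ι-cong n α≈β))

        ∼⇒≈ : x ∼ α → y ∼ α → x ≈ y
        ∼⇒≈ r s = U.trans X (el≈ι r) (U.sym X (el≈ι s))

        ∼-injective : x ∼ α → x ∼ β → P._≈_ n α β
        ∼-injective {n = n} r s = P.ι-injective n (U.trans X (U.sym X (el≈ι r)) (el≈ι s))

        private
          lifted : ∀ {m k} {α : P.∣_∣ m X} {β : P.∣_∣ n X} (m≤k : m ≤′ k) → (m , α) ∼ β →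
                   Levels._∼_ k n (_⊑_.incl (lift m≤k) X α) β
          lifted {α = α} m≤k r = U.trans X (_⊑_.isInclusion (lift m≤k) X α) (el≈ι r)

        -- The meet of `x` and `y` is computed at level `l ⊔ m`, that of `α` and `β` at level `n`.
        -- Both levels embed in their maximum, where `Agreement` applies, so the choice of level
        -- does not matter.
        ∧-∼ : ∀ {x y n} {α β : P.∣_∣ n X} → x ∼ α → y ∼ β → (x ∧ y) ∼ P._∧_ n α β
        ∧-∼ {x = l , _} {y = m , _} {n = n} r s = represents
          (Levels.∧-∼ (l ℕ.⊔ m) n (lifted (m≤′m⊔n l m) r) (lifted (n≤′m⊔n l m) s))

        ∨-∼ : ∀ {x y n} {α β : P.∣_∣ n X} → x ∼ α → y ∼ β → (x ∨ y) ∼ P._∨_ n α β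
        ∨-∼ {x = l , _} {y = m , _} {n = n} r s = represents
          (Levels.∨-∼ (l ℕ.⊔ m) n (lifted (m≤′m⊔n l m) r) (lifted (n≤′m⊔n l m) s))

        ¬-∼ : ∀ {x n} {α : P.∣_∣ n X} → x ∼ α → (¬ x) ∼ P.¬_ n α
        ¬-∼ {x = m , _} {n = n} r = represents (Levels.¬-∼ m n (el≈ι r))

        ⊤-∼ : ∀ n → ⊤ ∼ P.⊤ n
        ⊤-∼ n = represents (Levels.⊤-∼ 0 n)

        ⊥-∼ : ∀ n → ⊥ ∼ P.⊥ n
        ⊥-∼ n = represents (Levels.⊥-∼ 0 n)

        common : ∀ (x y : Element X) →
          ∃[ n ] Σ[ α ∈ P.∣_∣ n X ] Σ[ β ∈ P.∣_∣ n X ] x ∼ α × y ∼ β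
        common (l , _) (m , _) = l ℕ.⊔ m , _ , _ ,
          ∼-lift (m≤′m⊔n l m) (∼-self _) , ∼-lift (n≤′m⊔n l m) (∼-self _)

        common₃ : ∀ (x y z : Element X) → ∃[ n ] Σ[ α ∈ P.∣_∣ n X ] Σ[ β ∈ P.∣_∣ n X ]
          Σ[ γ ∈ P.∣_∣ n X ] x ∼ α × y ∼ β × z ∼ γ
        common₃ x y (k , γ) = let n , _ , _ , r , s = common x y in n ℕ.⊔ k , _ , _ , _ ,
          ∼-lift (m≤′m⊔n n k) r , ∼-lift (m≤′m⊔n n k) s , ∼-lift (n≤′m⊔n n k) (∼-self γ)

      -- Each law mentions at most three elements. They are represented at one level `n`, where the
      -- law holds, and both sides are represented by the corresponding terms. For the congruences,
      -- equal elements share a representative.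
      algebra : Obj → BooleanAlgebra b b
      algebra X = record
        { Carrier = Element X
        ; _≈_ = _≈_ ; _∨_ = _∨_ ; _∧_ = _∧_ ; ¬_ = ¬_ ; ⊤ = ⊤ ; ⊥ = ⊥
        ; isBooleanAlgebra = isBooleanAlgebraʳ record
          { isDistributiveLattice = isDistributiveLatticeʳʲᵐ record
            { isLattice = record
              { isEquivalence = On.isEquivalence el (Setoid.isEquivalence (U X))
              ; ∨-comm = λ x y → let n , α , β , r , s = common x y in
                  law n (B.∨-comm n α β) (∨-∼ r s) (∨-∼ s r)
              ; ∨-assoc = λ x y z → let n , α , β , γ , r , s , t = common₃ x y z in
                  law n (B.∨-assoc n α β γ) (∨-∼ (∨-∼ r s) t) (∨-∼ r (∨-∼ s t))
              ; ∨-cong = λ {x} {x′} {y} {y′} p q → let n , α , β , r , s = common x y in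
                  law n (B.refl n) (∨-∼ r s) (∨-∼ (∼-resp p r) (∼-resp q s))
              ; ∧-comm = λ x y → let n , α , β , r , s = common x y in
                  law n (B.∧-comm n α β) (∧-∼ r s) (∧-∼ s r)
              ; ∧-assoc = λ x y z → let n , α , β , γ , r , s , t = common₃ x y z in
                  law n (B.∧-assoc n α β γ) (∧-∼ (∧-∼ r s) t) (∧-∼ r (∧-∼ s t))
              ; ∧-cong = λ {x} {x′} {y} {y′} p q → let n , α , β , r , s = common x y in
                  law n (B.refl n) (∧-∼ r s) (∧-∼ (∼-resp p r) (∼-resp q s))
              ; absorptive =
                  (λ x y → let n , α , β , r , s = common x y in
                    law n (B.∨-absorbs-∧ n α β) (∨-∼ r (∧-∼ r s)) r) ,
                  (λ x y → let n , α , β , r , s = common x y in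
                    law n (B.∧-absorbs-∨ n α β) (∧-∼ r (∨-∼ r s)) r)
              }
            ; ∨-distribʳ-∧ = λ x y z → let n , α , β , γ , r , s , t = common₃ x y z in
                law n (B.∨-distribʳ-∧ n α β γ) (∨-∼ (∧-∼ s t) r) (∧-∼ (∨-∼ s r) (∨-∼ t r))
            }
          ; ∨-complementʳ = λ (n , α) → let r = ∼-self α in
              law n (B.∨-complementʳ n α) (∨-∼ r (¬-∼ r)) (⊤-∼ n)
          ; ∧-complementʳ = λ (n , α) → let r = ∼-self α in
              law n (B.∧-complementʳ n α) (∧-∼ r (¬-∼ r)) (⊥-∼ n)
          ; ¬-cong = λ { {n , α} p → let r = ∼-self α in
              law n (B.refl n) (¬-∼ r) (¬-∼ (∼-resp p r)) }
          }
        }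
        where
        law : ∀ n {α β : P.∣_∣ n X} {x y : Element X} →
              P._≈_ n α β → x ∼ α → y ∼ β → x ≈ y
        law n α≈β r s = ∼⇒≈ (∼-respʳ α≈β r) s

      map-element : ∀ {X Y} → Hom X Y → Element Y → Element X
      map-element f (n , α) = n , ⟦ P.map n f ⟧ α

      map-∼ : ∀ {X Y} (f : Hom X Y) {y n} {α : P.∣_∣ n Y} →
              y ∼ α → map-element f y ∼ ⟦ P.map n f ⟧ α
      map-∼ f {m , _} {n} r = represents (Levels.map-∼ m n f (el≈ι r))

      presheaf : Presheaf
      presheaf = record
        { algebra  = algebra
        ; map      = λ f → ∧-¬-homo⇒booleanHom (map-element f)
            (λ { {n , α} p → ∼⇒≈ (map-∼ f (∼-self α)) (map-∼ f (∼-resp p (∼-self α))) })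
            (λ x y → let n , α , β , r , s = common x y in
              ∼⇒≈ (∼-respʳ (BooleanHom.∧-homo (P.map n f) α β) (map-∼ f (∧-∼ r s)))
                  (∧-∼ (map-∼ f r) (map-∼ f s)))
            (λ (n , α) → P.ι-cong n (BooleanHom.¬-homo (P.map n f) α))
        ; map-cong = λ f≈g (n , α) → P.ι-cong n (P.map-cong n f≈g α)
        ; map-id   = λ (n , α) → P.ι-cong n (P.map-id n α)
        ; map-∘    = λ f g (n , α) → P.ι-cong n (P.map-∘ n f g α)
        }

      sub : SubPresheaf
      sub = record
        { presheaf = presheaf
        ; subsets  = λ X → record { to = el ; cong = λ p → p ; injective = λ p → p }
        }

      level⊑ : ∀ n → S.sub n ⊑ sub
      level⊑ n = record
        { inclusion = record
          { at = λ X → ∧-¬-homo⇒booleanHom (n ,_) (P.ι-cong n)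
              (λ α β → ∼⇒≈ (∼-self _) (∧-∼ (∼-self α) (∼-self β)))
              (λ α → U.refl X)
          ; natural = λ {X} f α → U.refl X
          }
        ; isInclusion = λ X α → U.refl X
        }

      -- With `level⊑`, this makes the union the least upper bound of the levels. The map is well
      -- defined because its values are fixed in `U X` and `R.ι` is injective.
      union⊑ : ∀ {R} → (∀ n → S.sub n ⊑ R) → sub ⊑ R
      union⊑ {R} r = record
        { inclusion = record
          { at = λ X → ∧-¬-homo⇒booleanHom (f X)
              (λ {x} {y} x≈y → R.ι-injective
                (U.trans X (f-ι x) (U.trans X x≈y (U.sym X (f-ι y)))))
              (λ x y → let n , α , β , s , t = common x y in
                R.trans (f-∼ (∧-∼ s t)) (R.trans (Incl.∧-homo (r n) α β)
                  (R.sym (R.∧-cong (f-∼ s) (f-∼ t)))))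
              (λ (n , α) → Incl.¬-homo (r n) α)
          ; natural = λ g (n , α) → Incl.natural (r n) g α
          }
        ; isInclusion = λ X x → f-ι x
        }
        where
        module R = Sub R

        f : ∀ X → Element X → R.∣ X ∣
        f X (n , α) = _⊑_.incl (r n) X α

        f-ι : ∀ {X} (x : Element X) → U._≈_ X (R.ι X (f X x)) (el x)
        f-ι (n , α) = _⊑_.isInclusion (r n) _ α

        f-∼ : ∀ {X x n} {α : P.∣_∣ n X} → x ∼ α → f X x R.≈ _⊑_.incl (r n) X α
        f-∼ {X} {x} {n} s = R.ι-injective
          (U.trans X (f-ι x) (U.trans X (el≈ι s) (U.sym X (_⊑_.isInclusion (r n) X _))))

      -- Quantifiers and quantifier-free fragment of the union.

      open Presheaf presheaf using (_≤_)

      ∀-element : ∀ {X} Y → Element (X ⊗ Y) → Element X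
      ∀-element Y (n , β) = ℕ.suc n , S.Step.∀[_] n Y β

      -- Both elements are lifted to level `m ⊔ n`, where they become equal and `∀-cong` applies;
      -- `lift-∀` returns to the original levels.
      ∀-∼ : ∀ {X} Y {y n} {β : P.∣_∣ n (X ⊗ Y)} →
            y ∼ β → ∀-element Y y ∼ S.Step.∀[_] n Y β
      ∀-∼ {X} Y {m , α} {n} {β} r = represents
        (U.trans X (U.sym X (lift-∀ (m≤′m⊔n m n) Y α))
        (U.trans X (P.ι-cong (ℕ.suc (m ℕ.⊔ n))
          (∀-cong (m ℕ.⊔ n) Y (Levels.∼⇒≈ m n (el≈ι r))))
          (lift-∀ (n≤′m⊔n m n) Y β)))

      ≤⇔≤ : ∀ {X} {x y : Element X} {n} {α β : P.∣_∣ n X} →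
            x ∼ α → y ∼ β → x ≤ y ⇔ P._≤_ n α β
      ≤⇔≤ r s = mk⇔ (λ x≤y → ∼-injective r (∼-resp (U.sym _ x≤y) (∧-∼ r s)))
                    (λ α≤β → ∼⇒≈ (∼-respʳ α≤β r) (∧-∼ r s))

      ∀-adjoint : ∀ {X} Y (x : Element X) (y : Element (X ⊗ Y)) →
        x ≤ ∀-element Y y ⇔ map-element pr₁ x ≤ y
      ∀-adjoint Y x y =
        -- The quantifier takes level `n` to level `suc n`, so `x` is represented at `suc n`. In the
        -- reindexed inequality `y` is lifted once more, matching the `i` in `universal`.
        ⇔-sym (≤⇔≤ (map-∼ pr₁ r′) (∼-lift (≤′-step ≤′-refl) s))
          ⇔-∘ (S.Step.universal n Y β _
          ⇔-∘ ≤⇔≤ r′ (∀-∼ Y s))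
        where
        n = proj₁ x ℕ.⊔ proj₁ y
        β = liftʳ (proj₁ x) (proj₁ y) (proj₂ y)

        r′ : x ∼ _
        r′ = ∼-lift (≤′-step (m≤′m⊔n (proj₁ x) (proj₁ y))) (∼-self (proj₂ x))

        s : y ∼ β
        s = ∼-lift (n≤′m⊔n (proj₁ x) (proj₁ y)) (∼-self (proj₂ y))

      firstOrder : FirstOrder presheaf
      firstOrder = record
        { ∀′ = λ X Y → mkPosetHomo (order (algebra (X ⊗ Y))) (order (algebra X)) (∀-element Y)
            (λ {y} {y′} → rightAdjoint-mono {P = order (algebra X)} {Q = order (algebra (X ⊗ Y))}
              (map-element pr₁) (λ x → ∀-adjoint Y x y) (λ x → ∀-adjoint Y x y′))
        ; adjoint = ∀-adjoint
        ; beckChevalley = λ Y f (n , β) → P.ι-cong (ℕ.suc n) (S.Step.beckChevalley n Y f β)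
        }

      -- Membership asks for a representative at level 0, not for the stored level to be 0; this
      -- makes it invariant under equality in the union.
      P₀ : ∀ X → Pred (Element X) b
      P₀ X x = Σ[ α ∈ P.∣_∣ 0 X ] x ∼ α

      -- The axiom `generated` writes `α` in terms of quantified elements of level `n`, which lie in
      -- stratum `n` by induction.
      ∼⇒Stratum : ∀ n {X} {x : Element X} (α : P.∣_∣ n X) →
        x ∼ α → x ∈ Stratum firstOrder P₀ n X
      ∼⇒Stratum ℕ.zero α r = α , r
      ∼⇒Stratum (ℕ.suc n) {X} {x} α r =
        resp (∼⇒≈ (∼-self α) r) (go (S.Step.generated n X α))
        where
        go : ∀ {α} → α ∈ Generated (P.algebra (ℕ.suc n) X)
               (λ x → ∃[ Y ] Σ[ β ∈ P.∣_∣ n (X ⊗ Y) ] P._≈_ (ℕ.suc n) x (S.Step.∀[_] n Y β)) →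
             (ℕ.suc n , α) ∈ Stratum firstOrder P₀ (ℕ.suc n) X
        go (gen (Y , β , α≈)) =
          gen (Y , (n , β) , ∼⇒Stratum n β (∼-self β) , P.ι-cong (ℕ.suc n) α≈)
        go (resp α≈β g) = resp (P.ι-cong (ℕ.suc n) α≈β) (go g)
        -- The top of the union is stored at level 0 and has to be identified with the top of level
        -- `suc n`.
        go ⊤-gen = resp (el≈ι (⊤-∼ (ℕ.suc n))) ⊤-gen
        go ⊥-gen = resp (el≈ι (⊥-∼ (ℕ.suc n))) ⊥-gen
        go (∧-gen g h) = resp (el≈ι (∧-∼ (∼-self _) (∼-self _))) (∧-gen (go g) (go h))
        go (∨-gen g h) = resp (el≈ι (∨-∼ (∼-self _) (∼-self _))) (∨-gen (go g) (go h))
        go (¬-gen g) = ¬-gen (go g)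

      -- Quantifying a representative of level `n` gives one of level `suc n`, and each level is
      -- closed under the Boolean operations.
      Stratum⇒∼ : ∀ n {X} {x : Element X} →
        x ∈ Stratum firstOrder P₀ n X → Σ[ α ∈ P.∣_∣ n X ] x ∼ α
      Stratum⇒∼ ℕ.zero x∈ = x∈
      Stratum⇒∼ (ℕ.suc n) (gen (Y , y , y∈ , x≈)) =
        let β , r = Stratum⇒∼ n y∈ in _ , ∼-resp (U.sym _ x≈) (∀-∼ Y r)
      Stratum⇒∼ (ℕ.suc n) (resp x≈y x∈) =
        let α , r = Stratum⇒∼ (ℕ.suc n) x∈ in α , ∼-resp x≈y r
      Stratum⇒∼ (ℕ.suc n) ⊤-gen = _ , ⊤-∼ (ℕ.suc n)
      Stratum⇒∼ (ℕ.suc n) ⊥-gen = _ , ⊥-∼ (ℕ.suc n)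
      Stratum⇒∼ (ℕ.suc n) (∧-gen x∈ y∈) =
        _ , ∧-∼ (proj₂ (Stratum⇒∼ (ℕ.suc n) x∈)) (proj₂ (Stratum⇒∼ (ℕ.suc n) y∈))
      Stratum⇒∼ (ℕ.suc n) (∨-gen x∈ y∈) =
        _ , ∨-∼ (proj₂ (Stratum⇒∼ (ℕ.suc n) x∈)) (proj₂ (Stratum⇒∼ (ℕ.suc n) y∈))
      Stratum⇒∼ (ℕ.suc n) (¬-gen x∈) = _ , ¬-∼ (proj₂ (Stratum⇒∼ (ℕ.suc n) x∈))

      union : FragmentedWithin
      union = record
        { doctrine = record
          { P = presheaf
          ; firstOrder = firstOrder
          ; P₀ = P₀
          ; isFragment = record
            { isSubalgebra = λ X → record
              { resp = λ x≈y (α , r) → α , ∼-resp x≈y r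
              ; ⊤-closed = _ , ⊤-∼ 0
              ; ⊥-closed = _ , ⊥-∼ 0
              ; ∧-closed = λ (α , r) (β , s) → _ , ∧-∼ r s
              ; ∨-closed = λ (α , r) (β , s) → _ , ∨-∼ r s
              ; ¬-closed = λ (α , r) → _ , ¬-∼ r
              }
            ; map-closed = λ f (α , r) → _ , map-∼ f r
            ; exhaustive = λ X (n , α) → n , ∼⇒Stratum n α (∼-self α)
            }
          }
        ; subsets = SubPresheaf.subsets sub
        }

    -- The two constructions are mutually inverse.

    open Directed using (union; union⊑; level⊑; Stratum⇒∼; ∼⇒Stratum)

    union-mono : ∀ {S T} → (∀ n → StratifiedWithin.sub S n ⊑ StratifiedWithin.sub T n) →
      Directed.sub S ⊑ Directed.sub T
    union-mono {S} {T} S⊑T = union⊑ S (λ n → ⊑-trans (S⊑T n) (level⊑ T n))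

    union-mono-P₀ : ∀ {S T}
      (S⊑T : ∀ n → StratifiedWithin.sub S n ⊑ StratifiedWithin.sub T n) →
      ∀ X {x} → x ∈ Directed.P₀ S X → _⊑_.incl (union-mono {S} {T} S⊑T) X x ∈ Directed.P₀ T X
    union-mono-P₀ {S} {T} S⊑T X {x} (α , r) = _⊑_.incl (S⊑T 0) X α , Directed.represents
      (U.trans X (_⊑_.isInclusion (union-mono {S} {T} S⊑T) X x)
        (U.trans X (Directed._∼_.el≈ι r) (U.sym X (_⊑_.isInclusion (S⊑T 0) X α))))

    union-cong : ∀ {S T} → S ≈ˢ T → union S ≈ᶠ union T
    union-cong {S} {T} S≈T = record
      { equal   = union-mono {S} {T} S⊑T , union-mono {T} {S} T⊑S
      ; P₀-to   = union-mono-P₀ {S} {T} S⊑T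
      ; P₀-from = union-mono-P₀ {T} {S} T⊑S
      }
      where
      S⊑T = λ n → proj₁ (S≈T n)
      T⊑S = λ n → proj₂ (S≈T n)

    -- Stratum `n` and level `n` both lie in the union, and `Stratum⇒∼` and `∼⇒Stratum` send each
    -- element of one to an element of the other that agrees with it.
    stratify-union : ∀ S → stratify (union S) ≈ˢ S
    stratify-union S n =
      Agreement.factor (stratum⊑ (union S) n) (level⊑ S n)
        (λ X (x , x∈) → proj₁ (Stratum⇒∼ S n x∈))
        (λ X (x , x∈) → Directed._∼_.el≈ι (proj₂ (Stratum⇒∼ S n x∈))) ,
      Agreement.factor (level⊑ S n) (stratum⊑ (union S) n)
        (λ X α → (n , α) , ∼⇒Stratum S n α (Directed.∼-self S α))
        (λ X α → U.refl X)

    union-stratify : ∀ F → union (stratify F) ≈ᶠ F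
    union-stratify F = record
      { equal   = U⊑F , Agreement.factor ⊑-refl U⊑F
          -- Exhaustiveness supplies the stratum at which `α` enters the union. The choice is
          -- harmless, since equality ignores levels.
          (λ X α → let n , α∈ = F.exhaustive X α in n , α , α∈) (λ X α → U.refl X)
      ; P₀-to   = λ X ((α , α∈) , r) → IsSubalgebra.resp (F.isSubalgebra X)
          (F.ι-injective (U.sym X (Directed._∼_.el≈ι r))) α∈
      ; P₀-from = λ X {α} α∈ → (α , α∈) , Directed.represents (U.refl X)
      }
      where
      module F = Fragmented F
      U⊑F : Directed.sub (stratify F) ⊑ F.sub
      U⊑F = union⊑ (stratify F) (stratum⊑ F)

  correspondence : (U : Obj → Setoid b b) → let open Within U in Inverse fragmented stratified
  correspondence U = record
    { to        = stratify U
    ; from      = Directed.union U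
    ; to-cong   = λ {F} {G} → stratify-cong U {F} {G}
    ; from-cong = λ {S} {T} → union-cong U {S} {T}
    ; inverse   =
        (λ {S} {F} F≈ → S.trans {stratify U F} {stratify U (Directed.union U S)} {S}
          (stratify-cong U {F} {Directed.union U S} F≈) (stratify-union U S)) ,
        (λ {F} {S} S≈ → F.trans {Directed.union U S} {Directed.union U (stratify U F)} {F}
          (union-cong U {S} {stratify U F} S≈) (union-stratify U F))
    }
    where
    open Within U using (fragmented; stratified)
    module F = Setoid fragmented
    module S = Setoid stratified

proposition3p13 : ∀ {o a e} (ℓ : Level) (C : FPCategory o a e) (U : FPCategory.Obj C → Setoid (o ⊔ ℓ) (o ⊔ ℓ)) →
    let open Doctrine ℓ C in
    let open Within U in
    Σ[ corr ∈ Inverse fragmented stratified ]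
    (∀ F → Inverse.to corr F IsStratificationOf F)
proposition3p13 ℓ C U = correspondence ℓ C U , stratify-isStratification ℓ C U
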